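{- Let $G$ be a graph on $[n]$ and let $e$ and $f$ be two crossing edges of $G$. Then $e$ and $f$ are crossing closed if and only if the join $e\vee f$ exists in $NC_G$. When $e$ and $f$ are crossing closed, $e\vee f$ is the bond whose edge set is $E(J(e,f))$, and $J(e,f)$ is the unique non-trivial connected component of $e\vee f$. Furthermore, $G$ is crossing closed if and only if $e\vee f$ exists in $NC_G$ for every pair of crossing edges $e,f$ of $G$.
   Context: All graphs are finite simple graphs with vertex set $[n]=\{1,\dots,n\}$; edges are written $ij$ with $i<j$. Two edges $a_1a_2$ and $b_1b_2$ cross if $a_1<b_1<a_2<b_2$ or $b_1<a_1<b_2<a_2$. A spanning subgraph is identified with its edge set. A bond of $G$ is a spanning subgraph of $G$ each of whose connected components is an induced subgraph of $G$. For a bond $H$, $\pi(H)$ is the set partition of $[n]$ whose blocks are the vertex sets of the connected components of $H$. A set partition is crossing if there are distinct blocks $B,B'$ and $a,c\in B$, $b,d\in B'$ with $a<b<c<d$, and noncrossing otherwise; a bond $H$ is noncrossing if $\pi(H)$ is noncrossing. $NC_G$ is the poset of noncrossing bonds of $G$ ordered by inclusion of edge sets. For an edge $e$, $e$ also denotes the bond with edge set $\{e\}$ (an element of $NC_G$). Two crossing edges $e,f$ are crossing closed if among all induced connected subgraphs of $G$ containing both $e$ and $f$ there is a unique one minimal with respect to containment, denoted $J(e,f)$; $G$ is crossing closed if every pair of crossing edges of $G$ is crossing closed. -}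

module Defs where

open import Level using (Level; 0ℓ; _⊔_)
open import Data.Bool.Base using (Bool; T)
open import Data.Nat.Base using (ℕ)
open import Data.Empty using (⊥-elim)
open import Data.Fin.Base using (Fin; _<_)
open import Data.Fin.Properties using (_≟_; <-asym; <-irrefl; <-trans)
open import Data.Fin.Subset using (Subset; ⊤; Nonempty; _∈_; _⊆_)
open import Data.Fin.Subset.Properties using (∈⊤)
open import Data.Product using (Σ; ∃; ∃₂; ∃!; _×_; _,_; proj₁; proj₂; swap)
open import Data.Sum.Base using (_⊎_; inj₁; inj₂)
open import Function.Base using (id)
open import Relation.Nullary using (¬_; Dec)
open import Relation.Nullary.Decidable using (_×-dec_; _⊎-dec_; ⌊_⌋; toWitness; fromWitness)
open import Relation.Unary using (Pred)
open import Relation.Binary.Bundles using (Poset)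
open import Relation.Binary.Core using (Rel; _⇒_)
open import Relation.Binary.Construct.Closure.ReflexiveTransitive using (Star; ε; _◅_)
open import Relation.Binary.PropositionalEquality using (_≡_; _≢_; refl; sym; trans)

private
  variable
    n : ℕ

------------------------------------------------------------------------
-- Graphs and subgraphs

-- The vertex set [n] is Fin n: only the order of the labels matters, so
-- they start at 0.
record Graph (n : ℕ) : Set where
  field
    adj        : Fin n → Fin n → Bool
    adj-sym    : ∀ {u v} → T (adj u v) → T (adj v u)
    adj-irrefl : ∀ {u} → ¬ T (adj u u)

  Adj : Rel (Fin n) 0ℓ
  Adj u v = T (adj u v)

open Graph public using (Adj)

-- Edge sets are Bool-valued, hence decidable, like the vertex sets.
record Subgraph (G : Graph n) : Set where
  field
    V     : Subset n
    edge  : Fin n → Fin n → Bool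
    E-sym : ∀ {u v} → T (edge u v) → T (edge v u)
    E⊆V   : ∀ {u v} → T (edge u v) → u ∈ V
    E⊆Adj : ∀ {u v} → T (edge u v) → Adj G u v

  E : Rel (Fin n) 0ℓ
  E u v = T (edge u v)

open Subgraph public using (V; E; E-sym; E⊆V; E⊆Adj)

module _ {G : Graph n} where

  infix 4 _⊑_ _≈_ _⊆ᴱ_ _≈ᴱ_

  _⊆ᴱ_ _≈ᴱ_ : Rel (Subgraph G) 0ℓ
  H ⊆ᴱ K = E H ⇒ E K
  H ≈ᴱ K = H ⊆ᴱ K × K ⊆ᴱ H

  _⊑_ _≈_ : Rel (Subgraph G) 0ℓ
  H ⊑ K = V H ⊆ V K × H ⊆ᴱ K
  H ≈ K = H ⊑ K × K ⊑ H

  Spanning : Pred (Subgraph G) 0ℓ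
  Spanning H = V H ≡ ⊤

  Induced : Pred (Subgraph G) 0ℓ
  Induced H = ∀ {u v} → u ∈ V H → v ∈ V H → Adj G u v → E H u v

  Connected : Pred (Subgraph G) 0ℓ
  Connected H = Nonempty (V H) × (∀ {u v} → u ∈ V H → v ∈ V H → Star (E H) u v)

  -- The maximal connected subgraphs of H.
  Component : Subgraph G → Pred (Subgraph G) 0ℓ
  Component H C =
    C ⊑ H × Connected C × (∀ D → D ⊑ H → Connected D → C ⊑ D → D ⊑ C)

  NonTrivial : Pred (Subgraph G) 0ℓ
  NonTrivial C = ∃₂ λ u v → u ∈ V C × v ∈ V C × u ≢ v

------------------------------------------------------------------------
-- Bonds and noncrossing partitions

  Bond : Pred (Subgraph G) 0ℓ
  Bond H = Spanning H × (∀ C → Component H C → Induced C)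

  -- The set partition π(H), given by its family of blocks.
  π : Subgraph G → Pred (Subset n) 0ℓ
  π H B = ∃ λ C → Component H C × V C ≡ B

CrossingPartition : Pred (Subset n) 0ℓ → Set
CrossingPartition P =
  ∃₂ λ B B′ → P B × P B′ × B ≢ B′ ×
    Σ (Fin _) λ a → Σ (Fin _) λ b → Σ (Fin _) λ c → Σ (Fin _) λ d →
      a ∈ B × c ∈ B × b ∈ B′ × d ∈ B′ × a < b × b < c × c < d

Noncrossing : Pred (Subset n) 0ℓ → Set
Noncrossing P = ¬ CrossingPartition P

record NCBond (G : Graph n) : Set where
  field
    graph       : Subgraph G
    bond        : Bond graph
    noncrossing : Noncrossing (π graph)

open NCBond public using (graph)

-- Bonds are spanning, so containment is inclusion of edge sets, and equality
-- in the poset is equality of edge sets.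
NC : Graph n → Poset 0ℓ 0ℓ 0ℓ
NC G = record
  { Carrier        = NCBond G
  ; _≈_            = λ H K → graph H ≈ᴱ graph K
  ; _≤_            = λ H K → graph H ⊆ᴱ graph K
  ; isPartialOrder = record
    { isPreorder = record
      { isEquivalence = record
        { refl  = id , id
        ; sym   = swap
        ; trans = λ (p , p′) (q , q′) → (λ x → q (p x)) , (λ x → p′ (q′ x))
        }
      ; reflexive = proj₁
      ; trans     = λ p q x → q (p x)
      }
    ; antisym = λ p q → p , q
    }
  }

module _ {a ℓ₁ ℓ₂ : Level} (P : Poset a ℓ₁ ℓ₂) where
  open Poset P using (Carrier; _≤_)

  IsJoin : Carrier → Carrier → Pred Carrier (a ⊔ ℓ₂)
  IsJoin x y z = x ≤ z × y ≤ z × (∀ w → x ≤ w → y ≤ w → z ≤ w)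

  JoinExists : Carrier → Carrier → Set (a ⊔ ℓ₂)
  JoinExists x y = ∃ (IsJoin x y)

------------------------------------------------------------------------
-- Edges, and an edge regarded as a noncrossing bond

record Edge (G : Graph n) : Set where
  field
    lo hi : Fin n
    lo<hi : lo < hi
    isAdj : Adj G lo hi

Crossing : {G : Graph n} → Rel (Edge G) 0ℓ
Crossing e f =
  (lo e < lo f × lo f < hi e × hi e < hi f) ⊎
  (lo f < lo e × lo e < hi f × hi f < hi e)
  where open Edge

module _ {G : Graph n} (e : Edge G) where
  open Edge e

  private
    Ends : Rel (Fin n) 0ℓ
    Ends u v = (u ≡ lo × v ≡ hi) ⊎ (u ≡ hi × v ≡ lo)

    ends? : ∀ u v → Dec (Ends u v)
    ends? u v = ((u ≟ lo) ×-dec (v ≟ hi)) ⊎-dec ((u ≟ hi) ×-dec (v ≟ lo))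

    ends-sym : ∀ {u v} → Ends u v → Ends v u
    ends-sym (inj₁ (p , q)) = inj₂ (q , p)
    ends-sym (inj₂ (p , q)) = inj₁ (q , p)

    ends-adj : ∀ {u v} → Ends u v → Adj G u v
    ends-adj (inj₁ (refl , refl)) = isAdj
    ends-adj (inj₂ (refl , refl)) = Graph.adj-sym G isAdj

    ends-back : ∀ {u v w} → Ends u v → Ends v w → u ≡ w
    ends-back (inj₁ (_ , refl)) (inj₁ (p , _))    = ⊥-elim (<-irrefl (sym p) lo<hi)
    ends-back (inj₁ (refl , _)) (inj₂ (_ , refl)) = refl
    ends-back (inj₂ (refl , _)) (inj₁ (_ , refl)) = refl
    ends-back (inj₂ (_ , refl)) (inj₂ (p , _))    = ⊥-elim (<-irrefl p lo<hi)

    ends-< : ∀ {u v} → Ends u v → u < v → u ≡ lo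
    ends-< (inj₁ (p , _))       _   = p
    ends-< (inj₂ (refl , refl)) u<v = ⊥-elim (<-asym u<v lo<hi)

  edgeGraph : Subgraph G
  edgeGraph = record
    { V     = ⊤
    ; edge  = λ u v → ⌊ ends? u v ⌋
    ; E-sym = λ {u} {v} p → fromWitness {a? = ends? v u} (ends-sym (toWitness {a? = ends? u v} p))
    ; E⊆V   = λ _ → ∈⊤
    ; E⊆Adj = λ {u} {v} p → ends-adj (toWitness {a? = ends? u v} p)
    }

  private
    ends : ∀ {u v} → E edgeGraph u v → Ends u v
    ends {u} {v} = toWitness {a? = ends? u v}

    path⇒edge : (C : Subgraph G) → C ⊆ᴱ edgeGraph →
                ∀ {u v} → u ≢ v → Star (E C) u v → E C u v
    path⇒edge C C⊆e u≢v ε             = ⊥-elim (u≢v refl)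
    path⇒edge C C⊆e u≢v (x ◅ ε)       = x
    path⇒edge C C⊆e u≢v (x ◅ y ◅ p)
      with refl ← ends-back (ends (C⊆e x)) (ends (C⊆e y)) = path⇒edge C C⊆e u≢v p

    component-lo : ∀ C → Component edgeGraph C →
                   ∀ {u v} → u ∈ V C → v ∈ V C → u < v → u ≡ lo
    component-lo C ((_ , C⊆e) , (_ , conn) , _) u∈ v∈ u<v =
      ends-< (ends (C⊆e (path⇒edge C C⊆e (λ u≡v → <-irrefl u≡v u<v) (conn u∈ v∈)))) u<v

  edgeBond : NCBond G
  edgeBond = record
    { graph       = edgeGraph
    ; bond        = refl , λ { C ((_ , C⊆e) , (_ , conn) , _) u∈ v∈ a →
        path⇒edge C C⊆e (λ { refl → Graph.adj-irrefl G a }) (conn u∈ v∈) }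
    ; noncrossing = λ { (_ , _ , (C , compC , refl) , (D , compD , refl) , _ ,
                         a , b , c , d , a∈ , c∈ , b∈ , d∈ , a<b , b<c , c<d) →
        <-irrefl (trans (component-lo C compC a∈ c∈ (<-trans a<b b<c))
                        (sym (component-lo D compD b∈ d∈ (<-trans b<c c<d)))) a<b }
    }

------------------------------------------------------------------------
-- Crossing closed pairs of edges

module _ {G : Graph n} where

  Contains : Subgraph G → Edge G → Set
  Contains K e = E K (Edge.lo e) (Edge.hi e)

  InducedConnected : Edge G → Edge G → Pred (Subgraph G) 0ℓ
  InducedConnected e f K = Induced K × Connected K × Contains K e × Contains K f

  Minimal : Pred (Subgraph G) 0ℓ → Pred (Subgraph G) 0ℓ
  Minimal P J = P J × (∀ K → P K → K ⊑ J → J ⊑ K)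

  -- Intended for crossing e and f; the crossing hypothesis is kept separate.
  CrossingClosed : Edge G → Edge G → Set
  CrossingClosed e f = ∃! _≈_ (Minimal (InducedConnected e f))

  J : (e f : Edge G) → CrossingClosed e f → Subgraph G
  J _ _ = proj₁

CrossingClosedGraph : Graph n → Set
CrossingClosedGraph G = (e f : Edge G) → Crossing e f → CrossingClosed e f

{-# OPTIONS --safe #-}
-- An induced connected K containing e and f becomes a noncrossing bond when
-- the remaining vertices are added as singletons, because only one block is
-- non-trivial. Conversely, in a noncrossing bond above e and f the component
-- of e also contains f, since otherwise their two blocks would cross. So
-- modulo isolated vertices the upper bounds of {e, f} and the induced
-- connected subgraphs containing e and f bound each other, and a least element
-- on one side is a least element on the other; finiteness turns a unique
-- minimal subgraph into a least one.
module Submission where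

open import Defs
open import Data.Bool.Base using (T)
open import Data.Empty using (⊥-elim)
open import Data.Fin.Base using (Fin)
open import Data.Fin.Properties using (all?; any?; <⇒≢; <-trans)
open import Data.Fin.Subset using (Subset; ⊤; ⁅_⁆; _∪_; _∈_; _∉_; _⊆_; _⊂_)
open import Data.Fin.Subset.Induction using (⊂-wellFounded; ⊃-wellFounded)
open import Data.Fin.Subset.Properties
  using (_∈?_; _⊂?_; ∈⊤; ⊆-antisym; ⊆-trans; anySubset?; nonempty?;
         p⊆p∪q; q⊆p∪q; x∈p∪q⁻; x∈⁅x⁆; x∈⁅y⁆⇒x≡y)
open import Data.Nat.Base using (ℕ)
open import Data.Product using (∃; _×_; _,_; proj₁; proj₂)
open import Data.Sum.Base using (inj₁; inj₂; [_,_]′)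
open import Function.Base using (id; _∘_)
open import Function.Bundles using (_⇔_; mk⇔)
open import Induction.WellFounded using (Acc; acc)
open import Level using (0ℓ)
open import Relation.Binary.Construct.Closure.ReflexiveTransitive
  using (Star; ε; _◅_; _◅◅_; gmap; reverse)
open import Relation.Binary.Core using (Rel)
open import Relation.Binary.Definitions using (Decidable)
open import Relation.Binary.PropositionalEquality using (_≡_; _≢_; refl; sym; subst)
open import Relation.Nullary using (Dec; yes; no)
open import Relation.Nullary.Decidable
  using (_×-dec_; _→-dec_; ¬?; ⌊_⌋; toWitness; fromWitness; map′; decidable-stable; T?)
open import Relation.Unary using (Pred)
import Relation.Unary as Unary

private
  variable
    n : ℕ
    G : Graph n

-- Reachability and minimal subsets by finite search.

Closed : Rel (Fin n) 0ℓ → Pred (Subset n) 0ℓ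
Closed R S = ∀ {x y} → x ∈ S → R x y → y ∈ S

closed-star : {R : Rel (Fin n) 0ℓ} {S : Subset n} → Closed R S → Closed (Star R) S
closed-star cl x∈ ε       = x∈
closed-star cl x∈ (r ◅ p) = closed-star cl (cl x∈ r) p

module _ {R : Rel (Fin n) 0ℓ} (R? : Decidable R) where

  -- Add the target of some edge leaving the set until no edge leaves it; strict growth within
  -- `Fin n` must stop. The invariant that every member is reached from `u` survives each addition.
  reachable : ∀ u → ∃ λ S → u ∈ S × Closed R S × (∀ {v} → v ∈ S → Star R u v)
  reachable u = grow ⁅ u ⁆ (⊃-wellFounded _) (x∈⁅x⁆ u)
      (λ v∈ → subst (Star R u) (sym (x∈⁅y⁆⇒x≡y u v∈)) ε)
    where
    grow : ∀ S → Acc (λ p q → q ⊂ p) S → u ∈ S → (∀ {v} → v ∈ S → Star R u v) →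
           ∃ λ S → u ∈ S × Closed R S × (∀ {v} → v ∈ S → Star R u v)
    grow S (acc rec) u∈ star
      with any? (λ x → any? (λ y → (x ∈? S) ×-dec R? x y ×-dec ¬? (y ∈? S)))
    ... | yes (x , y , x∈ , r , y∉) =
      grow (S ∪ ⁅ y ⁆)
        (rec (p⊆p∪q ⁅ y ⁆ , y , q⊆p∪q S ⁅ y ⁆ (x∈⁅x⁆ y) , y∉))
        (p⊆p∪q ⁅ y ⁆ u∈)
        ([ star , (λ v∈ → subst (Star R u) (sym (x∈⁅y⁆⇒x≡y y v∈)) (star x∈ ◅◅ (r ◅ ε))) ]′
          ∘ x∈p∪q⁻ S ⁅ y ⁆)
    ... | no ∄ = S , u∈ ,
      (λ {x} {y} x∈ r → decidable-stable (y ∈? S) (λ y∉ → ∄ (x , y , x∈ , r , y∉))) , star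

  star? : Decidable (Star R)
  star? u v with S , u∈ , cl , star ← reachable u =
    map′ star (closed-star cl u∈) (v ∈? S)

-- Since `P` is decidable, the search for a strictly smaller witness is finite, so one can descend
-- until none exists.
minimal-subset : {P : Pred (Subset n) 0ℓ} → Unary.Decidable P → ∀ {S} → P S →
                 ∃ λ T → P T × T ⊆ S × (∀ {U} → P U → U ⊆ T → T ⊆ U)
minimal-subset {n} {P} P? = shrink (⊂-wellFounded _)
  where
  shrink : ∀ {S} → Acc _⊂_ S → P S →
           ∃ λ T → P T × T ⊆ S × (∀ {U} → P U → U ⊆ T → T ⊆ U)
  shrink {S} (acc rec) pS with anySubset? (λ U → P? U ×-dec (U ⊂? S))
  ... | yes (U , pU , U⊂S) with T , pT , T⊆U , min ← shrink (rec U⊂S) pU =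
    T , pT , ⊆-trans T⊆U (proj₁ U⊂S) , min
  ... | no ∄ = S , pS , id , λ {U} pU U⊆S {x} x∈ →
    decidable-stable (x ∈? U) (λ x∉ → ∄ (U , pU , U⊆S , x , x∈ , x∉))

-- Restrictions and connected components.

full : (G : Graph n) → Subgraph G
full G = record
  { V     = ⊤
  ; edge  = Graph.adj G
  ; E-sym = Graph.adj-sym G
  ; E⊆V   = λ _ → ∈⊤
  ; E⊆Adj = id
  }

spanning : Subgraph G → Subgraph G
spanning K = record
  { V     = ⊤
  ; edge  = Subgraph.edge K
  ; E-sym = E-sym K
  ; E⊆V   = λ _ → ∈⊤
  ; E⊆Adj = E⊆Adj K
  }

E? : (H : Subgraph G) → Decidable (E H)
E? H u v = T? (Subgraph.edge H u v)

module _ {G : Graph n} (H : Subgraph G) (S : Subset n) where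

  private
    within? : ∀ u v → Dec (E H u v × u ∈ S × v ∈ S)
    within? u v = E? H u v ×-dec (u ∈? S) ×-dec (v ∈? S)

  ↾-edge⁺ : ∀ {u v} → E H u v × u ∈ S × v ∈ S → T ⌊ within? u v ⌋
  ↾-edge⁺ {u} {v} = fromWitness {a? = within? u v}

  ↾-edge⁻ : ∀ {u v} → T ⌊ within? u v ⌋ → E H u v × u ∈ S × v ∈ S
  ↾-edge⁻ {u} {v} = toWitness {a? = within? u v}

  -- The vertex set is S itself, so this is a subgraph of H only if S ⊆ V H.
  infix 8 _↾_
  _↾_ : Subgraph G
  _↾_ = record
    { V     = S
    ; edge  = λ u v → ⌊ within? u v ⌋
    ; E-sym = λ e → let h , u∈ , v∈ = ↾-edge⁻ e in ↾-edge⁺ (E-sym H h , v∈ , u∈)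
    ; E⊆V   = λ e → proj₁ (proj₂ (↾-edge⁻ e))
    ; E⊆Adj = λ e → E⊆Adj H (proj₁ (↾-edge⁻ e))
    }

  -- A walk that starts in a closed set never leaves it, so all its edges survive the restriction.
  ↾-star : Closed (E H) S → ∀ {u v} → u ∈ S → Star (E H) u v → Star (E _↾_) u v
  ↾-star cl u∈ ε       = ε
  ↾-star cl u∈ (h ◅ p) = ↾-edge⁺ (h , u∈ , cl u∈ h) ◅ ↾-star cl (cl u∈ h) p

V-closed : (K : Subgraph G) → Closed (E K) (V K)
V-closed K _ e = E⊆V K (E-sym K e)

first-edge : ∀ {R : Rel (Fin n) 0ℓ} {u v} → u ≢ v → Star R u v → ∃ (R u)
first-edge u≢v ε       = ⊥-elim (u≢v refl)
first-edge u≢v (r ◅ _) = _ , r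

-- `V K` is closed under the edges of `K`, hence under those of `C`, so walks in `C` from the shared
-- vertex `x` stay in it. This recovers vertex containment, on which the edge inclusions of `NC` are
-- silent.
connected-⊑ : (C K : Subgraph G) → Connected C → C ⊆ᴱ K →
              ∀ {x} → x ∈ V C → x ∈ V K → C ⊑ K
connected-⊑ C K (_ , conn) C⊆K x∈C x∈K =
  (λ v∈ → closed-star (λ u∈ e → V-closed K u∈ (C⊆K e)) x∈K (conn x∈C v∈)) , C⊆K

-- A non-trivial component has an edge; that edge lies in `K` and supplies a shared vertex.
-- Maximality of the component gives the other containment.
nontrivial-component : (H K : Subgraph G) → K ⊑ H → H ⊆ᴱ K → Connected K →
                       ∀ C → Component H C → NonTrivial C → C ≈ K
nontrivial-component H K K⊑H H⊆K connK C (C⊑H , connC , max) (u , v , u∈ , v∈ , u≢v)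
  with _ , e ← first-edge u≢v (proj₂ connC u∈ v∈) = C⊑K , max K K⊑H connK C⊑K
  where
  C⊑K : C ⊑ K
  C⊑K = connected-⊑ C K connC (λ e → H⊆K (proj₂ C⊑H e)) u∈ (E⊆V K (H⊆K (proj₂ C⊑H e)))

-- Take the restriction of `H` to the vertices reachable from `u`: any two of them are joined
-- through `u`, and a connected `D` above it has only vertices reachable from `u`.
component-at : (H : Subgraph G) → Spanning H → ∀ u →
               ∃ λ C → Component H C × u ∈ V C × Closed (E H) (V C) ×
                       (∀ {x y} → x ∈ V C → E H x y → E C x y)
component-at H span u with S , u∈ , cl , star ← reachable (E? H) u =
  H ↾ S
  , ( ((λ {x} _ → subst (x ∈_) (sym span) ∈⊤) , λ e → proj₁ (↾-edge⁻ H S e))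
    , ( (u , u∈)
      , λ x∈ y∈ → ↾-star H S cl x∈ (reverse (E-sym H) (star x∈) ◅◅ star y∈))
    , maximal)
  , u∈
  , cl
  , λ x∈ e → ↾-edge⁺ H S (e , x∈ , cl x∈ e)
  where
  maximal : ∀ D → D ⊑ H → Connected D → H ↾ S ⊑ D → D ⊑ H ↾ S
  maximal D D⊑H (_ , conn) C⊑D = V⊆ , λ e →
      ↾-edge⁺ H S (proj₂ D⊑H e , V⊆ (E⊆V D e) , V⊆ (V-closed D (E⊆V D e) e))
    where
    V⊆ : V D ⊆ S
    V⊆ v∈ = closed-star (λ x∈ e → cl x∈ (proj₂ D⊑H e)) u∈ (conn (proj₁ C⊑D u∈) v∈)

-- Noncrossing bonds versus induced connected subgraphs.

spanningBond : (K : Subgraph G) → Induced K → Connected K → NCBond G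
spanningBond {G = G} K ind conn = record
  { graph       = spanning K
  ; bond        = refl , λ C comp {u} {v} u∈ v∈ a →
      -- Adjacent vertices are distinct, so this component is non-trivial and hence is `K`.
      let C⊑K , K⊑C = only-K C comp (u , v , u∈ , v∈ , λ { refl → Graph.adj-irrefl G a })
      in proj₂ K⊑C (ind (proj₁ C⊑K u∈) (proj₁ C⊑K v∈) a)
  ; noncrossing = λ { (_ , _ , (C , compC , refl) , (D , compD , refl) , C≢D ,
                       a , b , c , d , a∈ , c∈ , b∈ , d∈ , a<b , b<c , c<d) →
      -- A crossing puts `a < c` in one block and `b < d` in the other, so both are non-trivial and
      -- both equal `V K`.
      let C⊑K , K⊑C = only-K C compC (a , c , a∈ , c∈ , <⇒≢ (<-trans a<b b<c))
          D⊑K , K⊑D = only-K D compD (b , d , b∈ , d∈ , <⇒≢ (<-trans b<c c<d))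
      in C≢D (⊆-antisym (⊆-trans (proj₁ C⊑K) (proj₁ K⊑D))
                        (⊆-trans (proj₁ D⊑K) (proj₁ K⊑C))) }
  }
  where
  only-K : ∀ C → Component (spanning K) C → NonTrivial C → C ≈ K
  only-K = nontrivial-component (spanning K) K ((λ _ → ∈⊤) , id) id conn

edge⊆ : (e : Edge G) (H : Subgraph G) → Contains H e → edgeGraph e ⊆ᴱ H
edge⊆ e H c {u} {v} p with toWitness p
... | inj₁ (refl , refl) = c
... | inj₂ (refl , refl) = E-sym H c

edge⊆⁻ : (e : Edge G) (H : Subgraph G) → edgeGraph e ⊆ᴱ H → Contains H e
edge⊆⁻ e H e⊆H = e⊆H (fromWitness (inj₁ (refl , refl)))

module _ {G : Graph n} (e f : Edge G) where

  open Edge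

  component-of-upper-bound :
    Crossing e f → (H : NCBond G) → edgeGraph e ⊆ᴱ graph H → edgeGraph f ⊆ᴱ graph H →
    ∃ λ C → InducedConnected e f C × Component (graph H) C
  component-of-upper-bound cross H e⊆H f⊆H
    with span , induced ← NCBond.bond H
    with C , compC , e∈C , closedC , edgeC ← component-at (graph H) span (lo e)
       | D , compD , f∈D , closedD , _     ← component-at (graph H) span (lo f)
    = C , (induced C compC , proj₁ (proj₂ compC) , edgeC e∈C e∈H , edgeC f∈C f∈H) , compC
    where
    e∈H : Contains (graph H) e
    e∈H = edge⊆⁻ e (graph H) e⊆H

    f∈H : Contains (graph H) f
    f∈H = edge⊆⁻ f (graph H) f⊆H

    crossing : lo f ∉ V C → CrossingPartition (π (graph H))
    crossing f∉C = [
      -- The edge with the smaller lower end supplies the block listed first.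
      (λ (p , q , r) → V C , V D , (C , compC , refl) , (D , compD , refl) , C≢D ,
        lo e , lo f , hi e , hi f , e∈C , closedC e∈C e∈H , f∈D , closedD f∈D f∈H , p , q , r) ,
      (λ (p , q , r) → V D , V C , (D , compD , refl) , (C , compC , refl) , C≢D ∘ sym ,
        lo f , lo e , hi f , hi e , f∈D , closedD f∈D f∈H , e∈C , closedC e∈C e∈H , p , q , r) ]′
      cross
      where
      C≢D : V C ≢ V D
      C≢D eq = f∉C (subst (lo f ∈_) (sym eq) f∈D)

    f∈C : lo f ∈ V C
    f∈C = decidable-stable (lo f ∈? V C) (λ f∉C → NCBond.noncrossing H (crossing f∉C))

  join-⊆ : ∀ H → IsJoin (NC G) (edgeBond e) (edgeBond f) H →
           ∀ K → InducedConnected e f K → graph H ⊆ᴱ K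
  join-⊆ H (_ , _ , least) K (ind , conn , e∈ , f∈) =
    least (spanningBond K ind conn) (edge⊆ e (spanning K) e∈) (edge⊆ f (spanning K) f∈)

  -- An induced subgraph is determined by its vertex set, so minimal ones can be sought among
  -- subsets.
  G[_] : Subset n → Subgraph G
  G[ S ] = full G ↾ S

  inducedConnected? : Unary.Decidable (λ S → InducedConnected e f G[ S ])
  inducedConnected? S = map′
    (λ (ne , star , e∈ , f∈) →
      (λ u∈ v∈ a → ↾-edge⁺ (full G) S (a , u∈ , v∈)) , (ne , λ {u} {v} → star u v) , e∈ , f∈)
    (λ (_ , (ne , star) , e∈ , f∈) → ne , (λ u v → star) , e∈ , f∈)
    (nonempty? S
      ×-dec all? (λ u → all? (λ v → (u ∈? S) →-dec ((v ∈? S) →-dec star? (E? G[ S ]) u v)))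
      ×-dec E? G[ S ] (lo e) (hi e)
      ×-dec E? G[ S ] (lo f) (hi f))

  ⊆⇒G[]⊑ : ∀ S K → Induced K → S ⊆ V K → G[ S ] ⊑ K
  ⊆⇒G[]⊑ S K ind S⊆K = S⊆K , λ p →
    let a , u∈ , v∈ = ↾-edge⁻ (full G) S p in ind (S⊆K u∈) (S⊆K v∈) a

  ⊑G[V] : ∀ K → K ⊆ᴱ G[ V K ]
  ⊑G[V] K p = ↾-edge⁺ (full G) (V K) (E⊆Adj K p , E⊆V K p , E⊆V K (E-sym K p))

  inducedConnected-G[V] : ∀ K → InducedConnected e f K → InducedConnected e f G[ V K ]
  inducedConnected-G[V] K (_ , (ne , star) , e∈ , f∈) =
    (λ u∈ v∈ a → ↾-edge⁺ (full G) (V K) (a , u∈ , v∈)) ,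
    (ne , λ u∈ v∈ → gmap id (⊑G[V] K) (star u∈ v∈)) ,
    ⊑G[V] K e∈ , ⊑G[V] K f∈

  minimal-below : ∀ K → InducedConnected e f K →
                  ∃ λ M → Minimal (InducedConnected e f) M × M ⊑ K
  minimal-below K ic@(ind , _)
    with S , icS , S⊆K , min ← minimal-subset inducedConnected? (inducedConnected-G[V] K ic) =
    G[ S ] ,
    -- A competitor `L` enters the search as `G[ V L ]`; its inducedness turns the resulting vertex
    -- containment into one of subgraphs.
    (icS , λ L icL L⊑ → ⊆⇒G[]⊑ S L (proj₁ icL) (min (inducedConnected-G[V] L icL) (proj₁ L⊑))) ,
    ⊆⇒G[]⊑ S K ind S⊆K

  -- Every `K` has some minimal `M` below it, and uniqueness identifies `M` with `J e f cc`.
  J-least : (cc : CrossingClosed e f) → ∀ K → InducedConnected e f K → J e f cc ⊑ K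
  J-least (_ , _ , unique) K ic with M , minM , M⊑K ← minimal-below K ic =
    let J⊑M = proj₁ (unique {M} minM)
    in (λ x → proj₁ M⊑K (proj₁ J⊑M x)) , (λ x → proj₂ M⊑K (proj₂ J⊑M x))

  crossingClosed⇒join : Crossing e f → CrossingClosed e f →
                        JoinExists (NC G) (edgeBond e) (edgeBond f)
  crossingClosed⇒join cross cc@(K , ((ind , conn , e∈ , f∈) , _) , _) =
    spanningBond K ind conn ,
    edge⊆ e (spanning K) e∈ ,
    edge⊆ f (spanning K) f∈ ,
    λ W e⊆W f⊆W → let C , icC , compC = component-of-upper-bound cross W e⊆W f⊆W
                  in λ x → proj₂ (proj₁ compC) (proj₂ (J-least cc C icC) x)

  join⇒crossingClosed : Crossing e f → JoinExists (NC G) (edgeBond e) (edgeBond f) →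
                        CrossingClosed e f
  join⇒crossingClosed cross (H , join@(e⊆H , f⊆H , _))
    with C , icC@(_ , connC , e∈C , _) , (C⊑H , _) ← component-of-upper-bound cross H e⊆H f⊆H =
    -- Another minimal `K` lies above `C` because `C` is least, and then below it by its own
    -- minimality.
    C , (icC , λ K icK _ → least K icK) , λ {K} (icK , minK) → least K icK , minK C icC (least K icK)
    where
    least : ∀ K → InducedConnected e f K → C ⊑ K
    least K icK@(_ , _ , e∈K , _) =
      connected-⊑ C K connC (λ x → join-⊆ H join K icK (proj₂ C⊑H x)) (E⊆V C e∈C) (E⊆V K e∈K)

  join-is-J :
    Crossing e f → ∀ (cc : CrossingClosed e f) H →
    IsJoin (NC G) (edgeBond e) (edgeBond f) H →
    graph H ≈ᴱ J e f cc ×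
    Component (graph H) (J e f cc) ×
    NonTrivial (J e f cc) ×
    (∀ C → Component (graph H) C → NonTrivial C → C ≈ J e f cc)
  join-is-J cross cc@(K , (icK@(_ , connK , e∈K , _) , _) , _) H join@(e⊆H , f⊆H , _)
    with C , icC , (C⊑H , _) ← component-of-upper-bound cross H e⊆H f⊆H =
    (H⊆K , proj₂ K⊑H) ,
    (K⊑H , connK , λ D D⊑H connD K⊑D →
      -- All edges of the join lie in `K`, so a connected `D` that shares `lo e` with `K` cannot
      -- leave it.
      connected-⊑ D K connD (λ x → H⊆K (proj₂ D⊑H x)) (proj₁ K⊑D (E⊆V K e∈K)) (E⊆V K e∈K)) ,
    (lo e , hi e , E⊆V K e∈K , E⊆V K (E-sym K e∈K) , <⇒≢ (lo<hi e)) ,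
    nontrivial-component (graph H) K K⊑H H⊆K connK
    where
    H⊆K : graph H ⊆ᴱ K
    H⊆K = join-⊆ H join K icK

    K⊑H : K ⊑ graph H
    K⊑H = let K⊑C = J-least cc C icC
          in (λ x → proj₁ C⊑H (proj₁ K⊑C x)) , (λ x → proj₂ C⊑H (proj₂ K⊑C x))

theorem2p5 : ∀ {n : ℕ} (G : Graph n) →
    (∀ (e f : Edge G) → Crossing e f →
    (CrossingClosed e f ⇔ JoinExists (NC G) (edgeBond e) (edgeBond f)) ×
    (∀ (cc : CrossingClosed e f) (H : NCBond G) →
    IsJoin (NC G) (edgeBond e) (edgeBond f) H →
    graph H ≈ᴱ J e f cc ×
    Component (graph H) (J e f cc) ×
    NonTrivial (J e f cc) ×
    (∀ C → Component (graph H) C → NonTrivial C → C ≈ J e f cc)))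
    ×
    (CrossingClosedGraph G ⇔
    (∀ (e f : Edge G) → Crossing e f →
    JoinExists (NC G) (edgeBond e) (edgeBond f)))
theorem2p5 G =
  (λ e f cross → mk⇔ (crossingClosed⇒join e f cross) (join⇒crossingClosed e f cross) , join-is-J e f cross) ,
  mk⇔ (λ cc e f cross → crossingClosed⇒join e f cross (cc e f cross))
      (λ join e f cross → join⇒crossingClosed e f cross (join e f cross))
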